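{- For every positive integer $k$, the graph $G_k$ (defined in the context) satisfies ${\rm diam}(G_k)\le 2k+6$ and $\chi_{\rho}(G_k)\ge 2k+9$.
   Context: All graphs are finite and simple; $d(u,v)$ denotes the shortest-path distance and ${\rm diam}$ the diameter. For a positive integer $i$, an $i$-packing in a graph $G$ is a set $W\subseteq V(G)$ such that any two distinct vertices of $W$ are at distance greater than $i$. The packing chromatic number $\chi_\rho(G)$ is the smallest integer $k$ such that $V(G)$ can be partitioned into sets $V_1,\dots,V_k$ with $V_i$ an $i$-packing for each $i$. The graph $H$ has 15 vertices $y_1,\dots,y_7,z_1,\dots,z_7,w$ and edges $y_1y_5, y_5y_6, y_6y_7, y_7y_3, y_3y_2, y_2y_1, y_2y_4, y_4y_6$, the analogous edges $z_1z_5, z_5z_6, z_6z_7, z_7z_3, z_3z_2, z_2z_1, z_2z_4, z_4z_6$, and the edges $y_4w, wz_4, y_3z_1, y_5z_7$. The graph $G_0$ is obtained from two disjoint copies $H^{(1)}, H^{(2)}$ of $H$ (the vertex of $H^{(j)}$ corresponding to $v\in V(H)$ is written $v^{(j)}$) by adding five new vertices $a,b,c,d,x$ and the edges: $a$ adjacent to $y_1^{(1)}$ and $y_1^{(2)}$; $b$ adjacent to $z_3^{(1)}$ and $z_3^{(2)}$; $c$ adjacent to $y_7^{(1)}$ and $z_5^{(2)}$; $d$ adjacent to $z_5^{(1)}$ and $y_7^{(2)}$; $x$ adjacent to $w^{(1)}$ and $w^{(2)}$. For a positive integer $k$, the graph $G_k$ is built as follows. Take five perfect binary trees $A,B,C,D,X$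 of depth $k$; the vertices of a tree $T\in\{A,B,C,D,X\}$ are $T(\beta)$ for all binary strings $\beta$ of length $0,1,\dots,k$ ($T()$ is the root), and for $|\beta|<k$ the vertex $T(\beta)$ is adjacent to its two children $T(0\beta)$ and $T(1\beta)$ (a bit is prepended on the left). For each binary string $\beta$ of length $k$ take a copy $G_0(\beta)$ of $G_0$ (copies pairwise disjoint), and identify the vertex $a$ of $G_0(\beta)$ with the leaf $A(\beta)$, $b$ with $B(\beta)$, $c$ with $C(\beta)$, $d$ with $D(\beta)$, and $x$ with $X(\beta)$. -}

module Defs where

open import Data.Nat using (ℕ; zero; suc; _≤_; _<_; _+_; _*_)
open import Data.Fin using (Fin; toℕ)
open import Data.Bool using (Bool)
open import Data.List using (List; []; _∷_; length)
open import Data.Product using (Σ; ∃; _×_; _,_)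
open import Data.Sum using (_⊎_)
open import Relation.Nullary using (¬_)
open import Relation.Binary.PropositionalEquality using (_≡_; _≢_)

record Graph : Set₁ where
  field
    V   : Set
    Adj : V → V → Set

module _ (G : Graph) where
  open Graph G

  data Walk : V → V → ℕ → Set where
    nil  : ∀ {u} → Walk u u 0
    cons : ∀ {u v w n} → Adj u v → Walk v w n → Walk u w (suc n)

  DistLe : V → V → ℕ → Set
  DistLe u v n = Σ ℕ λ m → m ≤ n × Walk u v m

  DiamLe : ℕ → Set
  DiamLe D = ∀ (u v : V) → DistLe u v D

  IsPacking : ℕ → (V → Set) → Set
  IsPacking i W = ∀ u v → W u → W v → u ≢ v → ¬ DistLe u v i

  -- a packing colouring with colours 1..m: colour class of colour (toℕ f + 1)
  -- (the set V_{toℕ f + 1}) is a (toℕ f + 1)-packing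
  PackingColouring : ℕ → Set
  PackingColouring m =
    Σ (V → Fin m) λ c → ∀ (f : Fin m) → IsPacking (suc (toℕ f)) (λ v → c v ≡ f)

  PackingChromaticGe : ℕ → Set
  PackingChromaticGe N = ∀ m → m < N → ¬ PackingColouring m

data HV : Set where
  y1 y2 y3 y4 y5 y6 y7 z1 z2 z3 z4 z5 z6 z7 w : HV

data HEdge : HV → HV → Set where
  e-y1y5 : HEdge y1 y5
  e-y5y6 : HEdge y5 y6
  e-y6y7 : HEdge y6 y7
  e-y7y3 : HEdge y7 y3
  e-y3y2 : HEdge y3 y2
  e-y2y1 : HEdge y2 y1
  e-y2y4 : HEdge y2 y4
  e-y4y6 : HEdge y4 y6
  e-z1z5 : HEdge z1 z5
  e-z5z6 : HEdge z5 z6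
  e-z6z7 : HEdge z6 z7
  e-z7z3 : HEdge z7 z3
  e-z3z2 : HEdge z3 z2
  e-z2z1 : HEdge z2 z1
  e-z2z4 : HEdge z2 z4
  e-z4z6 : HEdge z4 z6
  e-y4w  : HEdge y4 w
  e-wz4  : HEdge w z4
  e-y3z1 : HEdge y3 z1
  e-y5z7 : HEdge y5 z7

data Copy : Set where
  c1 c2 : Copy

-- the five trees / the five extra vertices a,b,c,d,x of G_0
data TName : Set where
  A B C D X : TName

-- neighbour of the extra vertex (a,b,c,d,x) in copy j of H, in G_0
attach : TName → Copy → HV
attach A _  = y1
attach B _  = z3
attach C c1 = y7
attach C c2 = z5
attach D c1 = z5
attach D c2 = y7
attach X _  = w

-- Vertices: tree vertices T(β), |β| ≤ k (leaves |β| = k are identified with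
-- a,b,c,d,x of G_0(β)); and the vertices v^(j) of the copy G_0(β), |β| = k.
data Vk (k : ℕ) : Set where
  tree : TName → (β : List Bool) → .(length β ≤ k) → Vk k
  hv   : (β : List Bool) → .(length β ≡ k) → Copy → HV → Vk k

data Ek (k : ℕ) : Vk k → Vk k → Set where
  treeE   : ∀ {T β} (b : Bool) .{p : length β ≤ k} .{q : length (b ∷ β) ≤ k} →
            Ek k (tree T β p) (tree T (b ∷ β) q)
  hE      : ∀ {β} .{p q : length β ≡ k} {j u v} → HEdge u v →
            Ek k (hv β p j u) (hv β q j v)
  attachE : ∀ {T β} .{p : length β ≤ k} .{q : length β ≡ k} (j : Copy) →
            Ek k (tree T β p) (hv β q j (attach T j))

G : ℕ → Graph
G k = record { V = Vk k ; Adj = λ u v → Ek k u v ⊎ Ek k v u }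

{-# OPTIONS --safe #-}

-- Since G_0 consists of two copies of H, and G_{k+1} of two copies of G_k, joined
-- along five further vertices, the lower bound is an induction. Call a colour large
-- in a graph if it is at least the diameter, so that it is used at most once. With
-- one colour too few, a graph has only three large colours, so one of its two parts
-- misses two of them and is itself coloured with one colour too few. This leaves a
-- finite search showing that H has no packing colouring with 6 colours.
-- For the diameter, any two vertices of copies of H have distances to their
-- attaching vertices of a common tree that add up to at most 4.
module Submission where

open import Defs
open import Data.Nat using (ℕ; _≤_; _+_; _*_)
open import Data.Product using (_×_)
open import Data.Bool using (Bool; true; false; T; _∧_; _∨_; not)
open import Data.Bool.ListAction using (all; any)
open import Data.Bool.Properties using (T-∧; T-∨)
open import Data.Empty using (⊥)
open import Data.Fin using (toℕ; #_)
open import Data.Fin.Properties using (toℕ-injective; toℕ<n)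
open import Data.List using (List; []; _∷_; length; upTo; lookup; applyDownFrom; _∷ʳ_)
open import Data.List.Membership.Propositional using (_∈_; find)
open import Data.List.Membership.Propositional.Properties using (∈-lookup; ∈-upTo⁺; ∈-upTo⁻)
open import Data.List.Properties using (∷ʳ-injective; length-++-comm)
open import Data.List.Relation.Binary.Permutation.Propositional using (_↭_; ↭-refl; ↭-trans; prep; swap)
open import Data.List.Relation.Binary.Permutation.Propositional.Properties
  using (∈-resp-↭; All-resp-↭; ↭-length)
open import Data.List.Relation.Unary.All as All using (All; []; _∷_)
open import Data.List.Relation.Unary.All.Properties using (all⁺)
open import Data.List.Relation.Unary.AllPairs using ([]; _∷_; allPairs?)
open import Data.List.Relation.Unary.Any as Any using (here; there)
open import Data.List.Relation.Unary.Any.Properties using (any⁻; lookup-index)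
open import Data.List.Relation.Unary.Unique.Propositional using (Unique)
open import Data.Nat using (zero; suc; _∸_; _<_; z≤n; s≤s)
import Data.Nat.Base as ℕ
import Data.Nat.Properties as ℕ
open import Data.Nat.Tactic.RingSolver using (solve-∀)
open import Data.Product using (∃; ∃₂; Σ; _,_; proj₁; proj₂)
open import Data.Sum as Sum using (_⊎_; inj₁; inj₂)
open import Data.Unit using (tt)
open import Function using (_∘_; Equivalence)
open import Relation.Binary using (DecidableEquality)
open import Relation.Binary.PropositionalEquality
  using (_≡_; _≢_; refl; sym; trans; cong; subst; module ≡-Reasoning)
open import Relation.Nullary using (¬_; ¬?; contradiction)
open import Relation.Nullary.Decidable using (map′; from-yes; recompute)

-- Packing colourings and large colours

module _ (G : Graph) where
  open Graph G

  Packings : (V → ℕ) → Set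
  Packings c = ∀ i → IsPacking G (suc i) (λ v → c v ≡ i)

  -- Colours are counted from 0, so colour i needs distance greater than i + 1;
  -- besides the colours below t, three colours ps of larger index are allowed.
  Uncolourable : ℕ → Set
  Uncolourable t = ∀ c → Packings c →
    ∀ ps → length ps ≡ 3 → All (t ≤_) ps → ¬ (∀ v → c v < t ⊎ c v ∈ ps)

DistLe-weaken : ∀ {G u v m n} → m ≤ n → DistLe G u v m → DistLe G u v n
DistLe-weaken m≤n (l , l≤m , p) = l , ℕ.≤-trans l≤m m≤n , p

-- Colour `p` forbids distances up to `suc p`, hence every distance in `G`. The conclusion is doubly
-- negated because vertices of `G` need not have decidable equality.
large-once : ∀ {G d} → DiamLe G (suc d) → ∀ {c} → Packings G c →
  ∀ {p u v} → d ≤ p → c u ≡ p → c v ≡ p → ¬ u ≢ v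
large-once diam pack {p} {u} {v} d≤p cu cv u≢v =
  pack p u v cu cv u≢v (DistLe-weaken (s≤s d≤p) (diam u v))

-- Distances in `H`

H : Graph
H = record { V = HV ; Adj = λ u v → HEdge u v ⊎ HEdge v u }

vertices : List HV
vertices = y1 ∷ y2 ∷ y3 ∷ y4 ∷ y5 ∷ y6 ∷ y7 ∷ z1 ∷ z2 ∷ z3 ∷ z4 ∷ z5 ∷ z6 ∷ z7 ∷ w ∷ []

-- Numbering the vertices reduces equality tests to `ℕ`, avoiding a case split over 225 pairs.
index : HV → ℕ
index y1 = 0
index y2 = 1
index y3 = 2
index y4 = 3
index y5 = 4
index y6 = 5
index y7 = 6
index z1 = 7
index z2 = 8
index z3 = 9
index z4 = 10
index z5 = 11
index z6 = 12
index z7 = 13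
index w  = 14

∈-vertices : ∀ v → v ∈ vertices
∈-vertices y1 = ∈-lookup (# 0)
∈-vertices y2 = ∈-lookup (# 1)
∈-vertices y3 = ∈-lookup (# 2)
∈-vertices y4 = ∈-lookup (# 3)
∈-vertices y5 = ∈-lookup (# 4)
∈-vertices y6 = ∈-lookup (# 5)
∈-vertices y7 = ∈-lookup (# 6)
∈-vertices z1 = ∈-lookup (# 7)
∈-vertices z2 = ∈-lookup (# 8)
∈-vertices z3 = ∈-lookup (# 9)
∈-vertices z4 = ∈-lookup (# 10)
∈-vertices z5 = ∈-lookup (# 11)
∈-vertices z6 = ∈-lookup (# 12)
∈-vertices z7 = ∈-lookup (# 13)
∈-vertices w  = ∈-lookup (# 14)

index-position : ∀ v → toℕ (Any.index (∈-vertices v)) ≡ index v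
index-position y1 = refl
index-position y2 = refl
index-position y3 = refl
index-position y4 = refl
index-position y5 = refl
index-position y6 = refl
index-position y7 = refl
index-position z1 = refl
index-position z2 = refl
index-position z3 = refl
index-position z4 = refl
index-position z5 = refl
index-position z6 = refl
index-position z7 = refl
index-position w  = refl

index-injective : ∀ {u v} → index u ≡ index v → u ≡ v
index-injective {u} {v} eq = begin
  u                                           ≡⟨ lookup-index (∈-vertices u) ⟩
  lookup vertices (Any.index (∈-vertices u))  ≡⟨ cong (lookup vertices) (toℕ-injective same-position) ⟩
  lookup vertices (Any.index (∈-vertices v))  ≡⟨ lookup-index (∈-vertices v) ⟨
  v                                           ∎
  where
  open ≡-Reasoning
  same-position : toℕ (Any.index (∈-vertices u)) ≡ toℕ (Any.index (∈-vertices v))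
  same-position = trans (index-position u) (trans eq (sym (index-position v)))

_≟_ : DecidableEquality HV
u ≟ v = map′ index-injective (cong index) (index u ℕ.≟ index v)

-- Each neighbour comes with its edge, so that a successful search by `within` yields a walk.
neighbours : ∀ u → List (∃ (Graph.Adj H u))
neighbours y1 = (y5 , inj₁ e-y1y5) ∷ (y2 , inj₂ e-y2y1) ∷ []
neighbours y2 = (y1 , inj₁ e-y2y1) ∷ (y3 , inj₂ e-y3y2) ∷ (y4 , inj₁ e-y2y4) ∷ []
neighbours y3 = (y2 , inj₁ e-y3y2) ∷ (y7 , inj₂ e-y7y3) ∷ (z1 , inj₁ e-y3z1) ∷ []
neighbours y4 = (y2 , inj₂ e-y2y4) ∷ (y6 , inj₁ e-y4y6) ∷ (w , inj₁ e-y4w) ∷ []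
neighbours y5 = (y1 , inj₂ e-y1y5) ∷ (y6 , inj₁ e-y5y6) ∷ (z7 , inj₁ e-y5z7) ∷ []
neighbours y6 = (y5 , inj₂ e-y5y6) ∷ (y7 , inj₁ e-y6y7) ∷ (y4 , inj₂ e-y4y6) ∷ []
neighbours y7 = (y6 , inj₂ e-y6y7) ∷ (y3 , inj₁ e-y7y3) ∷ []
neighbours z1 = (z5 , inj₁ e-z1z5) ∷ (z2 , inj₂ e-z2z1) ∷ (y3 , inj₂ e-y3z1) ∷ []
neighbours z2 = (z1 , inj₁ e-z2z1) ∷ (z3 , inj₂ e-z3z2) ∷ (z4 , inj₁ e-z2z4) ∷ []
neighbours z3 = (z2 , inj₁ e-z3z2) ∷ (z7 , inj₂ e-z7z3) ∷ []
neighbours z4 = (z2 , inj₂ e-z2z4) ∷ (z6 , inj₁ e-z4z6) ∷ (w , inj₂ e-wz4) ∷ []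
neighbours z5 = (z1 , inj₂ e-z1z5) ∷ (z6 , inj₁ e-z5z6) ∷ []
neighbours z6 = (z5 , inj₂ e-z5z6) ∷ (z7 , inj₁ e-z6z7) ∷ (z4 , inj₂ e-z4z6) ∷ []
neighbours z7 = (z6 , inj₂ e-z6z7) ∷ (z3 , inj₁ e-z7z3) ∷ (y5 , inj₂ e-y5z7) ∷ []
neighbours w  = (y4 , inj₂ e-y4w) ∷ (z4 , inj₁ e-wz4) ∷ []

within : ℕ → HV → HV → Bool
within zero    u v = index u ℕ.≡ᵇ index v
within (suc n) u v = (index u ℕ.≡ᵇ index v) ∨ any (λ (x , _) → within n x v) (neighbours u)

within⇒DistLe : ∀ n u v → T (within n u v) → DistLe H u v n
within⇒DistLe zero u v h with refl ← index-injective {u} {v} (ℕ.≡ᵇ⇒≡ _ _ h) = 0 , z≤n , nil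
within⇒DistLe (suc n) u v h with Equivalence.to T-∨ h
... | inj₁ eq with refl ← index-injective {u} {v} (ℕ.≡ᵇ⇒≡ _ _ eq) = 0 , z≤n , nil
... | inj₂ h′
  with (x , e) , _ , h″ ← find (any⁻ _ (neighbours u) h′)
  with m , m≤n , p ← within⇒DistLe n x v h″ = suc m , s≤s m≤n , cons e p

-- Proof by evaluation: for a concrete test that computes to `true` everywhere, `tt` is the premise.
all⇒∀ : ∀ (p : HV → Bool) → T (all p vertices) → ∀ v → T (p v)
all⇒∀ p h v = All.lookup (all⁺ p vertices h) (∈-vertices v)

all⇒∀₂ : ∀ (p : HV → HV → Bool) → T (all (λ u → all (p u) vertices) vertices) → ∀ u v → T (p u v)
all⇒∀₂ p h u = all⇒∀ (p u) (all⇒∀ (λ u → all (p u) vertices) h u)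

diam-H : DiamLe H 4
diam-H u v = within⇒DistLe 4 u v (all⇒∀₂ (within 4) tt u v)

-- The parts `m` and `4 ∸ m` cost 4 steps inside copies of `H`. With two attaching edges and at most
-- `2k` edges through the root of the tree `t`, this gives `2k + 6`.
detour? : Copy → Copy → HV → HV → Bool
detour? i j u v =
  any (λ t → any (λ m → within m (attach t i) u ∧ within (4 ∸ m) (attach t j) v) (upTo 5))
      (A ∷ B ∷ C ∷ D ∷ X ∷ [])

detour?-holds : ∀ i j u v → T (detour? i j u v)
detour?-holds c1 c1 = all⇒∀₂ (detour? c1 c1) tt
detour?-holds c1 c2 = all⇒∀₂ (detour? c1 c2) tt
detour?-holds c2 c1 = all⇒∀₂ (detour? c2 c1) tt
detour?-holds c2 c2 = all⇒∀₂ (detour? c2 c2) tt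

detour : ∀ i j u v → ∃₂ λ t m → m ≤ 4 × DistLe H (attach t i) u m × DistLe H (attach t j) v (4 ∸ m)
detour i j u v
  with t , _ , h ← find (any⁻ _ (A ∷ B ∷ C ∷ D ∷ X ∷ []) (detour?-holds i j u v))
  with m , m∈ , h′ ← find (any⁻ _ (upTo 5) h)
  with h₁ , h₂ ← Equivalence.to T-∧ h′
  = t , m , ℕ.s≤s⁻¹ (∈-upTo⁻ m∈) , within⇒DistLe m _ u h₁ , within⇒DistLe (4 ∸ m) _ v h₂

-- Exhaustive search for packing colourings of `H`

clash : HV → ℕ → HV × ℕ → Bool
clash v i (u , j) = (i ℕ.≡ᵇ j) ∧ within (suc i) u v ∧ not (index u ℕ.≡ᵇ index v)

-- Backtracking over the vertices vs, given the vertices P already coloured below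
-- t and the number of unspent large colours. As each of these is spent on one
-- vertex, it does not matter which one is used.
mutual
  refuted : ℕ → List HV → List (HV × ℕ) → ℕ → Bool
  refuted t []       P n = false
  refuted t (v ∷ vs) P n = refuted-large t vs P n ∧
    all (λ i → any (clash v i) P ∨ refuted t vs ((v , i) ∷ P) n) (upTo t)

  refuted-large : ℕ → List HV → List (HV × ℕ) → ℕ → Bool
  refuted-large t vs P zero    = true
  refuted-large t vs P (suc n) = refuted t vs P n

-- Serves to strike a spent large colour off the list.
∈⇒↭ : ∀ {A : Set} {x : A} {xs} → x ∈ xs → ∃ λ ys → xs ↭ x ∷ ys
∈⇒↭ (here refl) = _ , ↭-refl
∈⇒↭ (there x∈) with ys , p ← ∈⇒↭ x∈ = _ , ↭-trans (prep _ p) (swap _ _ ↭-refl)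

module _ {c : HV → ℕ} (packings : Packings H c) {t : ℕ} (3≤t : 3 ≤ t) where

  no-clash : ∀ {v P} → All (λ (u , j) → c u ≡ j) P → ¬ T (any (clash v (c v)) P)
  no-clash {v} {P} coloured h
    with (u , j) , u∈P , h′ ← find (any⁻ _ P h)
    with i≡j , h″ ← Equivalence.to T-∧ h′
    with near , u≢v ← Equivalence.to T-∧ h″
    = packings (c v) u v (trans (All.lookup coloured u∈P) (sym (ℕ.≡ᵇ⇒≡ _ _ i≡j))) refl
        (λ { refl → not-T u≢v (ℕ.≡⇒≡ᵇ (index u) _ refl) })
        (within⇒DistLe (suc (c v)) u v near)
    where
    not-T : ∀ {b} → T (not b) → ¬ T b
    not-T {false} _ ()

  -- A colouring `c` would pick one branch at each vertex, and no branch survives the search. As `H`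
  -- has diameter at most 4, `3 ≤ t` makes all colours in `ps` large.
  refuted-sound : ∀ vs P ps → Unique vs → All (λ (u , j) → c u ≡ j) P → All (t ≤_) ps →
    All (λ v → c v < t ⊎ c v ∈ ps) vs → ¬ T (refuted t vs P (length ps))
  refuted-sound (v ∷ vs) P ps (v∉vs ∷ uniq) coloured large (inj₁ cv<t ∷ cols) h
    with Equivalence.to T-∨ (All.lookup (all⁺ _ (upTo t) (proj₂ (Equivalence.to T-∧ h))) (∈-upTo⁺ cv<t))
  ... | inj₁ clashes = no-clash coloured clashes
  ... | inj₂ h′ = refuted-sound vs ((v , c v) ∷ P) ps uniq (refl ∷ coloured) large cols h′
  refuted-sound (v ∷ vs) P ps (v∉vs ∷ uniq) coloured large (inj₂ cv∈ ∷ cols) h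
    with qs , ps↭ ← ∈⇒↭ cv∈
    with t≤cv ∷ large′ ← All-resp-↭ ps↭ large
    -- `v` is not recorded in `P`: its colour is absent from the remaining choices, so no later
    -- vertex can clash with it.
    = refuted-sound vs P qs uniq coloured large′
        (All.zipWith (λ (v≢u , col) → Sum.map₂ (other v≢u) col) (v∉vs , cols))
        (subst (T ∘ refuted-large t vs P) (↭-length ps↭) (proj₁ (Equivalence.to T-∧ h)))
    where
    other : ∀ {u} → v ≢ u → c u ∈ ps → c u ∈ qs
    other v≢u cu∈ with ∈-resp-↭ ps↭ cu∈
    ... | here cu≡cv = contradiction v≢u (large-once diam-H packings (ℕ.≤-trans 3≤t t≤cv) refl cu≡cv)
    ... | there cu∈qs = cu∈qs

H-uncolourable : Uncolourable H 3
H-uncolourable c packings ps |ps|≡3 large cols =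
  refuted-sound packings ℕ.≤-refl vertices [] ps unique [] large (All.universal cols vertices)
    -- Here `tt` runs the whole search, with colours 0, 1, 2 and three large ones.
    (subst (T ∘ refuted 3 vertices []) (sym |ps|≡3) tt)
  where
  unique : Unique vertices
  unique = from-yes (allPairs? (λ u v → ¬? (u ≟ v)) vertices)

-- Embeddings and the doubling step

record _↪_ (G′ G : Graph) : Set where
  field
    to        : Graph.V G′ → Graph.V G
    to-adj    : ∀ {u v} → Graph.Adj G′ u v → Graph.Adj G (to u) (to v)
    injective : ∀ {u v} → to u ≡ to v → u ≡ v

  to-DistLe : ∀ {u v n} → DistLe G′ u v n → DistLe G (to u) (to v) n
  to-DistLe (m , m≤n , p) = m , m≤n , to-Walk p
    where
    to-Walk : ∀ {u v m} → Walk G′ u v m → Walk G (to u) (to v) m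
    to-Walk nil        = nil
    to-Walk (cons e p) = cons (to-adj e) (to-Walk p)

  -- Distinct vertices that are close in `G′` have distinct images at least as close in `G`.
  Packings-∘ : ∀ {c} → Packings G c → Packings G′ (c ∘ to)
  Packings-∘ packings i u v cu cv u≢v d =
    packings i (to u) (to v) cu cv (u≢v ∘ injective) (to-DistLe d)

-- Turns the top `n` colours into listed ones, as `Uncolourable` expects.
<-+-split : ∀ n {t x} → x < n + t → x < t ⊎ x ∈ applyDownFrom (_+ t) n
<-+-split zero    x<t = inj₁ x<t
<-+-split (suc n) x<1+n+t with ℕ.m<1+n⇒m<n∨m≡n x<1+n+t
... | inj₁ x<n+t = Sum.map₂ there (<-+-split n x<n+t)
... | inj₂ x≡n+t = inj₂ (here x≡n+t)

-- The three large colours are used once each, so one of the two copies misses two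
-- of them; there the colours t and t + 1 take over their role.
Uncolourable-double : ∀ {G G′} (e₁ e₂ : G′ ↪ G) → (∀ u v → _↪_.to e₁ u ≢ _↪_.to e₂ v) →
  ∀ {t} → DiamLe G (3 + t) → Uncolourable G′ t → Uncolourable G (2 + t)
Uncolourable-double {G} {G′} e₁ e₂ disjoint {t} diam bad c packings
  (p ∷ q ∷ r ∷ []) refl (lp ∷ lq ∷ lr ∷ []) cols =
  missed lp λ mp → missed lq λ mq → missed lr λ mr → pigeonhole mp mq mr
  where
  Misses : G′ ↪ G → ℕ → Set
  Misses e s = ∀ v → c (_↪_.to e v) ≢ s

  -- If both copies used `s`, two distinct vertices would share a large colour. Which copy misses
  -- `s` is not decidable in general, but a double negation suffices for the goal `⊥`.
  missed : ∀ {s} → 2 + t ≤ s → (Misses e₁ s ⊎ Misses e₂ s → ⊥) → ⊥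
  missed l k = k (inj₁ λ u cu → k (inj₂ λ v cv →
    large-once diam packings l cu cv (disjoint u v)))

  one-left : ∀ e s → t ≤ s → All (λ s′ → s′ ≡ s ⊎ Misses e s′) (p ∷ q ∷ r ∷ []) → ⊥
  one-left e s t≤s left =
    bad (c ∘ to) (Packings-∘ packings) (s ∷ suc t ∷ t ∷ []) refl
      (t≤s ∷ ℕ.n≤1+n t ∷ ℕ.≤-refl ∷ []) cols′
    where
    open _↪_ e
    cols′ : ∀ v → c (to v) < t ⊎ c (to v) ∈ s ∷ suc t ∷ t ∷ []
    cols′ v with cols (to v)
    ... | inj₁ cv<2+t = Sum.map₂ there (<-+-split 2 cv<2+t)
    ... | inj₂ cv∈ with All.lookup left cv∈
    ...   | inj₁ cv≡s = inj₂ (here cv≡s)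
    ...   | inj₂ miss = contradiction refl (miss v)

  below : ∀ {s} → 2 + t ≤ s → t ≤ s
  below = ℕ.≤-trans (ℕ.m≤n+m t 2)

  pigeonhole : Misses e₁ p ⊎ Misses e₂ p → Misses e₁ q ⊎ Misses e₂ q → Misses e₁ r ⊎ Misses e₂ r → ⊥
  pigeonhole (inj₁ mp) (inj₁ mq) _         = one-left e₁ r (below lr) (inj₂ mp ∷ inj₂ mq ∷ inj₁ refl ∷ [])
  pigeonhole (inj₁ mp) (inj₂ mq) (inj₁ mr) = one-left e₁ q (below lq) (inj₂ mp ∷ inj₁ refl ∷ inj₂ mr ∷ [])
  pigeonhole (inj₁ mp) (inj₂ mq) (inj₂ mr) = one-left e₂ p (below lp) (inj₁ refl ∷ inj₂ mq ∷ inj₂ mr ∷ [])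
  pigeonhole (inj₂ mp) (inj₁ mq) (inj₁ mr) = one-left e₁ p (below lp) (inj₁ refl ∷ inj₂ mq ∷ inj₂ mr ∷ [])
  pigeonhole (inj₂ mp) (inj₁ mq) (inj₂ mr) = one-left e₂ q (below lq) (inj₂ mp ∷ inj₁ refl ∷ inj₂ mr ∷ [])
  pigeonhole (inj₂ mp) (inj₂ mq) _         = one-left e₂ r (below lr) (inj₂ mp ∷ inj₂ mq ∷ inj₁ refl ∷ [])

-- Copies of `H` in `G k` and of `G k` in `G (suc k)`

copy-of-H : ∀ {k} β → .(length β ≡ k) → Copy → H ↪ G k
copy-of-H β p j = record
  { to        = hv β p j
  ; to-adj    = Sum.map hE hE
  ; injective = λ { refl → refl }
  }

string : ∀ {k} → Vk k → List Bool
string (tree _ β _) = β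
string (hv β _ _ _) = β

label : ∀ {k} → Vk k → TName ⊎ (Copy × HV)
label (tree t _ _)  = inj₁ t
label (hv _ _ j v) = inj₂ (j , v)

-- Lets injectivity of `append` be read off from labels and strings, since unification cannot invert
-- `β ∷ʳ b`.
Vk-ext : ∀ {k} (u v : Vk k) → label u ≡ label v → string u ≡ string v → u ≡ v
Vk-ext (tree _ _ _) (tree _ _ _) refl refl = refl
Vk-ext (hv _ _ _ _) (hv _ _ _ _) refl refl = refl

module _ {k : ℕ} (b : Bool) where

  -- Children prepend their bit, so the last bit records the branch taken at the root: the strings
  -- ending in `b` belong to the half below the child `b` of each root.
  append : Vk k → Vk (suc k)
  append (tree t β p) = tree t (β ∷ʳ b)
    (subst (_≤ suc k) (sym (length-++-comm β (b ∷ []))) (s≤s p))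
  append (hv β p j v) = hv (β ∷ʳ b)
    (trans (length-++-comm β (b ∷ [])) (cong suc p)) j v

  append-edge : ∀ {u v} → Ek k u v → Ek (suc k) (append u) (append v)
  append-edge (treeE b′)  = treeE b′
  append-edge (hE e)      = hE e
  append-edge (attachE j) = attachE j

  string-append : ∀ u → string (append u) ≡ string u ∷ʳ b
  string-append (tree _ _ _) = refl
  string-append (hv _ _ _ _) = refl

  label-append : ∀ u → label (append u) ≡ label u
  label-append (tree _ _ _) = refl
  label-append (hv _ _ _ _) = refl

-- Admitting two bits gives both injectivity of each half and disjointness of the halves.
append-string-injective : ∀ {k b b′} (u v : Vk k) → append b u ≡ append b′ v → string u ≡ string v × b ≡ b′
append-string-injective {b = b} {b′} u v eq = ∷ʳ-injective (string u) (string v)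
  (trans (sym (string-append b u)) (trans (cong string eq) (string-append b′ v)))

half : ∀ {k} → Bool → G k ↪ G (suc k)
half b = record
  { to        = append b
  ; to-adj    = Sum.map (append-edge b) (append-edge b)
  ; injective = λ {u} {v} eq → Vk-ext u v
      (trans (sym (label-append b u)) (trans (cong label eq) (label-append b v)))
      (proj₁ (append-string-injective u v eq))
  }

-- The diameter of `G k`

DistLe-refl : ∀ {G u} → DistLe G u u 0
DistLe-refl = 0 , z≤n , nil

DistLe-trans : ∀ {G u v w m n} → DistLe G u v m → DistLe G v w n → DistLe G u w (m + n)
DistLe-trans {G} (m , m≤ , p) (n , n≤ , q) = m + n , ℕ.+-mono-≤ m≤ n≤ , p ++ʷ q
  where
  _++ʷ_ : ∀ {u v w m n} → Walk G u v m → Walk G v w n → Walk G u w (m + n)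
  nil      ++ʷ q = q
  cons e p ++ʷ q = cons e (p ++ʷ q)

module _ {k : ℕ} where

  edge : ∀ {u v} → Ek k u v → DistLe (G k) u v 1
  edge e = 1 , s≤s z≤n , cons (inj₁ e) nil

  DistLe-sym : ∀ {u v n} → DistLe (G k) u v n → DistLe (G k) v u n
  DistLe-sym (m , m≤n , p) = m , m≤n , subst (Walk (G k) _ _) (ℕ.+-identityʳ m) (reverse p nil)
    where
    reverse : ∀ {u v w m n} → Walk (G k) u v m → Walk (G k) u w n → Walk (G k) v w (m + n)
    reverse nil q = q
    reverse {n = n} (cons {n = m} e p) q =
      subst (Walk (G k) _ _) (ℕ.+-suc m n) (reverse p (cons (Sum.swap e) q))

  to-root : ∀ t β .(p : length β ≤ k) → DistLe (G k) (tree t β p) (tree t [] z≤n) (length β)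
  to-root t []      p = DistLe-refl {G k}
  to-root t (b ∷ β) p = DistLe-trans (DistLe-sym (edge (treeE b))) (to-root t β (ℕ.<⇒≤ p))

  to-root′ : ∀ t β .(p : length β ≤ k) → DistLe (G k) (tree t β p) (tree t [] z≤n) k
  to-root′ t β p = DistLe-weaken {G k} (recompute (length β ℕ.≤? k) p) (to-root t β p)

  to-leaf : ∀ n t β .(p : length β ≤ k) → n + length β ≡ k →
    ∃ λ γ → Σ (length γ ≡ k) λ q → DistLe (G k) (tree t β p) (tree t γ (ℕ.≤-reflexive q)) n
  to-leaf zero    t β p eq = β , eq , DistLe-refl {G k}
  to-leaf (suc n) t β p eq
    with γ , q , d ← to-leaf n t (true ∷ β) (subst (suc (length β) ≤_) eq (s≤s (ℕ.m≤n+m _ n)))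
                       (trans (ℕ.+-suc n (length β)) eq)
    = γ , q , DistLe-trans (edge (treeE true)) d

  to-copy : ∀ t γ .(p : length γ ≤ k) .(q : length γ ≡ k) j {v n} → DistLe H (attach t j) v n →
    DistLe (G k) (tree t γ p) (hv γ q j v) (suc n)
  to-copy t γ p q j d = DistLe-trans (edge (attachE j)) (_↪_.to-DistLe (copy-of-H γ q j) d)

  -- One edge into a copy of `H`, at most 4 steps across it, one edge out.
  cross : ∀ t t′ γ .(p : length γ ≤ k) .(q : length γ ≡ k) →
    DistLe (G k) (tree t γ p) (tree t′ γ p) 6
  cross t t′ γ p q =
    DistLe-trans (to-copy t γ p q c1 (diam-H _ _)) (DistLe-sym (edge (attachE c1)))

  -- Descend to a leaf, cross to the other tree, climb to its root and descend again. Starting at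
  -- the deeper vertex keeps the two descents together within `k`.
  tree-tree : ∀ t t′ β γ .(p : length β ≤ k) .(q : length γ ≤ k) → length γ ≤ length β →
    DistLe (G k) (tree t β p) (tree t′ γ q) (k * 2 + 6)
  tree-tree t t′ β γ p q γ≤β
    with δ , |δ|≡k , down ← to-leaf (k ∸ length β) t β p (ℕ.m∸n+n≡m (recompute (length β ℕ.≤? k) p))
    = DistLe-weaken {G k} bound
        (DistLe-trans down
        (DistLe-trans (cross t t′ δ (ℕ.≤-reflexive |δ|≡k) |δ|≡k)
        (DistLe-trans (to-root′ t′ δ (ℕ.≤-reflexive |δ|≡k)) (DistLe-sym (to-root t′ γ q)))))
    where
    rearrange : ∀ m k n → m + (6 + (k + n)) ≡ (m + n) + (k + 6)
    rearrange = solve-∀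
    double : ∀ k → k + (k + 6) ≡ k * 2 + 6
    double = solve-∀
    open ℕ.≤-Reasoning
    bound : (k ∸ length β) + (6 + (k + length γ)) ≤ k * 2 + 6
    bound = begin
      (k ∸ length β) + (6 + (k + length γ))  ≡⟨ rearrange (k ∸ length β) k (length γ) ⟩
      (k ∸ length β) + length γ + (k + 6)    ≤⟨ ℕ.+-monoˡ-≤ (k + 6) (ℕ.+-monoʳ-≤ (k ∸ length β) γ≤β) ⟩
      (k ∸ length β) + length β + (k + 6)    ≡⟨ cong (_+ (k + 6)) (ℕ.m∸n+n≡m (recompute (length β ℕ.≤? k) p)) ⟩
      k + (k + 6)                            ≡⟨ double k ⟩
      k * 2 + 6                              ∎

  -- The route through the root of `t` has length at most `2k + 5`, one below the bound.
  tree-copy : ∀ t β γ .(p : length β ≤ k) .(q : length γ ≡ k) j v →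
    DistLe (G k) (tree t β p) (hv γ q j v) (k * 2 + 6)
  tree-copy t β γ p q j v = DistLe-weaken {G k} (ℕ.≤-trans (ℕ.n≤1+n _) (ℕ.≤-reflexive (bound k)))
    (DistLe-trans (to-root′ t β p)
    (DistLe-trans (DistLe-sym (to-root′ t γ (ℕ.≤-reflexive q))) (to-copy t γ _ q j (diam-H _ v))))
    where
    bound : ∀ k → suc (k + (k + 5)) ≡ k * 2 + 6
    bound = solve-∀

  copy-copy : ∀ β γ .(p : length β ≡ k) .(q : length γ ≡ k) i j u v →
    DistLe (G k) (hv β p i u) (hv γ q j v) (k * 2 + 6)
  copy-copy β γ p q i j u v with t , m , m≤4 , d , d′ ← detour i j u v =
    DistLe-weaken {G k} (ℕ.≤-reflexive bound)
      (DistLe-trans (DistLe-sym (to-copy t β (ℕ.≤-reflexive p) p i d))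
      (DistLe-trans (to-root′ t β (ℕ.≤-reflexive p))
      (DistLe-trans (DistLe-sym (to-root′ t γ (ℕ.≤-reflexive q)))
                    (to-copy t γ (ℕ.≤-reflexive q) q j d′))))
    where
    rearrange : ∀ m n k → suc m + (k + (k + suc n)) ≡ k * 2 + 2 + (m + n)
    rearrange = solve-∀
    bound : suc m + (k + (k + suc (4 ∸ m))) ≡ k * 2 + 6
    bound = trans (rearrange m (4 ∸ m) k)
      (trans (cong (k * 2 + 2 +_) (ℕ.m+[n∸m]≡n m≤4)) (ℕ.+-assoc (k * 2) 2 4))

diam-G : ∀ k → DiamLe (G k) (k * 2 + 6)
diam-G k (tree t β p)  (hv γ q j v)  = tree-copy t β γ p q j v
diam-G k (hv γ q j v)  (tree t β p)  = DistLe-sym (tree-copy t β γ p q j v)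
diam-G k (hv β p i u)  (hv γ q j v)  = copy-copy β γ p q i j u v
diam-G k (tree t β p)  (tree t′ γ q) with ℕ.≤-total (length γ) (length β)
... | inj₁ γ≤β = tree-tree t t′ β γ p q γ≤β
... | inj₂ β≤γ = DistLe-sym (tree-tree t′ t γ β q p β≤γ)

-- The lower bound by induction on the depth

diam-G′ : ∀ k → DiamLe (G k) (suc (k * 2 + 5))
diam-G′ k = subst (DiamLe (G k)) (ℕ.+-suc (k * 2) 5) (diam-G k)

-- Threshold and diameter bound both grow by 2 with `k`, so the threshold stays one below the bound,
-- as doubling requires. The base `G 0` has single vertices as trees.
G-uncolourable : ∀ k → Uncolourable (G k) (k * 2 + 5)
G-uncolourable zero = Uncolourable-double (copy-of-H [] refl c1) (copy-of-H [] refl c2)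
  (λ _ _ ()) (diam-G′ 0) H-uncolourable
G-uncolourable (suc k) = Uncolourable-double (half false) (half true)
  (λ u v eq → contradiction (proj₂ (append-string-injective u v eq)) λ ())
  (diam-G′ (suc k)) (G-uncolourable k)

-- At most `3 + t` colours, counted from 0, are those below `t` and the three colours `t`, `1 + t`,
-- `2 + t`.
Uncolourable⇒PackingChromaticGe : ∀ {G t} → Uncolourable G t → PackingChromaticGe G (4 + t)
Uncolourable⇒PackingChromaticGe {G} {t} bad m (s≤s m≤3+t) (c , packing) =
  bad (toℕ ∘ c) packings (2 + t ∷ 1 + t ∷ t ∷ []) refl
    (ℕ.m≤n+m t 2 ∷ ℕ.n≤1+n t ∷ ℕ.≤-refl ∷ [])
    (λ v → <-+-split 3 (ℕ.≤-trans (toℕ<n (c v)) m≤3+t))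
  where
  packings : Packings G (toℕ ∘ c)
  packings _ u v refl cv = packing (c u) u v refl (toℕ-injective cv)

theorem6 : (k : ℕ) → 1 ≤ k →
    DiamLe (G k) (2 * k + 6) × PackingChromaticGe (G k) (2 * k + 9)
theorem6 k _ =
  subst (λ n → DiamLe (G k) (n + 6)) (ℕ.*-comm k 2) (diam-G k) ,
  subst (PackingChromaticGe (G k)) (4+k*2+5≡2*k+9 k) (Uncolourable⇒PackingChromaticGe (G-uncolourable k))
  where
  4+k*2+5≡2*k+9 : ∀ k → 4 + (k * 2 + 5) ≡ 2 * k + 9
  4+k*2+5≡2*k+9 = solve-∀
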